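{- For every message $M$: $\vdash\neg\neg\mathsf{k}_{\mathsf{CM}}(M)$.
   Context: Fix a finite set $\mathcal{A}$ of agent names containing a distinguished name $\mathsf{CM}$. Messages: $M ::= a \mid B \mid (M,M)$ ($a\in\mathcal{A}$, $B$ optional data constants, pairs). $\mathcal{P}$ is a denumerable set of propositional variables containing atoms $\mathsf{k}_a(M)$ ("$a$ knows $M$"). Formulas: $\phi ::= P \mid \phi\wedge\phi \mid \phi\vee\phi \mid \neg\phi \mid \phi\to\phi \mid [M]\phi$. Abbreviations: $\mathrm{true}:=\mathsf{k}_{\mathsf{CM}}(\mathsf{CM})$, $\mathrm{false}:=\neg\mathrm{true}$, $\phi\leftrightarrow\psi:=(\phi\to\psi)\wedge(\psi\to\phi)$, $\langle M\rangle\phi:=\neg\neg(\mathsf{k}_{\mathsf{CM}}(M)\wedge\phi)$. LIiP is the smallest set of formulas containing all instances of: the axioms of an adequate Hilbert axiomatization of intuitionistic propositional logic; $\mathsf{k}_a(a)$; $(\mathsf{k}_a(M)\wedge\mathsf{k}_a(M'))\leftrightarrow\mathsf{k}_a((M,M'))$; $[M]\mathsf{k}_{\mathsf{CM}}(M)$; $[M](\phi\to\psi)\to([M]\phi\to[M]\psi)$; $[M]\phi\to(\mathsf{k}_{\mathsf{CM}}(M)\to\phi)$; $[M]\phi\to\langle M\rangle\phi$; $\phi\to[M]\phi$; and closed under modus ponens and the rule: if $\mathsf{k}_{\mathsf{CM}}(M)\to\mathsf{k}_{\mathsf{CM}}(M')$ is in the set then so is $[M']\phi\to[M]\phi$ for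 every $\phi$. Write $\vdash\phi$ for $\phi\in\mathrm{LIiP}$. -}

module Defs where

open import Data.Fin using (Fin)
open import Data.Nat using (ℕ)
open import Data.Product using (_×_; _,_; ∃-syntax)
open import Function.Bundles using (_↔_; _↣_; module Injection)

infixr 4 ⟪_,_⟫

data Message (Agent Datum : Set) : Set where
  agent : Agent → Message Agent Datum
  datum : Datum → Message Agent Datum
  ⟪_,_⟫ : Message Agent Datum → Message Agent Datum → Message Agent Datum

record Language : Set₁ where
  field
    Agent       : Set
    finite      : ∃[ n ] (Agent ↔ Fin n)
    CM          : Agent
    -- Data constants are optional: Datum may be empty.
    Datum       : Set
    Var         : Set
    denumerable : Var ↔ ℕ
    -- The atoms k a M are pairwise distinct elements of Var, which may
    -- contain further variables besides them.
    atom        : (Agent × Message Agent Datum) ↣ Var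

module LIiP (L : Language) where

  open Language L public

  Msg : Set
  Msg = Message Agent Datum

  infix  9 ~_
  infix  9 [_]_ ⟨_⟩_
  infixr 7 _∧_
  infixr 6 _∨_
  infixr 5 _⇒_
  infix  4 _⇔_
  infix  3 ⊢_

  data Formula : Set where
    var  : Var → Formula
    _∧_  : Formula → Formula → Formula
    _∨_  : Formula → Formula → Formula
    ~_   : Formula → Formula
    _⇒_  : Formula → Formula → Formula
    [_]_ : Msg → Formula → Formula

  k : Agent → Msg → Formula
  k a M = var (Injection.to atom (a , M))

  true : Formula
  true = k CM (agent CM)

  false : Formula
  false = ~ true

  _⇔_ : Formula → Formula → Formula
  φ ⇔ ψ = (φ ⇒ ψ) ∧ (ψ ⇒ φ)

  ⟨_⟩_ : Msg → Formula → Formula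
  ⟨ M ⟩ φ = ~ (~ (k CM M ∧ φ))

  -- Kleene's axioms for intuitionistic propositional logic with primitive
  -- negation; φ, ψ, χ range over all formulas, including modal ones.
  data IPC : Formula → Set where
    weaken  : ∀ φ ψ → IPC (φ ⇒ (ψ ⇒ φ))
    distr   : ∀ φ ψ χ → IPC ((φ ⇒ (ψ ⇒ χ)) ⇒ ((φ ⇒ ψ) ⇒ (φ ⇒ χ)))
    ∧-elimˡ : ∀ φ ψ → IPC ((φ ∧ ψ) ⇒ φ)
    ∧-elimʳ : ∀ φ ψ → IPC ((φ ∧ ψ) ⇒ ψ)
    ∧-intro : ∀ φ ψ → IPC (φ ⇒ (ψ ⇒ (φ ∧ ψ)))
    ∨-introˡ : ∀ φ ψ → IPC (φ ⇒ (φ ∨ ψ))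
    ∨-introʳ : ∀ φ ψ → IPC (ψ ⇒ (φ ∨ ψ))
    ∨-elim  : ∀ φ ψ χ → IPC ((φ ⇒ χ) ⇒ ((ψ ⇒ χ) ⇒ ((φ ∨ ψ) ⇒ χ)))
    ~-intro : ∀ φ ψ → IPC ((φ ⇒ ψ) ⇒ ((φ ⇒ (~ ψ)) ⇒ (~ φ)))
    ~-elim  : ∀ φ ψ → IPC ((~ φ) ⇒ (φ ⇒ ψ))

  data ⊢_ : Formula → Set where
    ipc        : ∀ {φ} → IPC φ → ⊢ φ
    self-name  : ∀ a → ⊢ k a (agent a)
    pairing    : ∀ a M M′ → ⊢ ((k a M ∧ k a M′) ⇔ k a ⟪ M , M′ ⟫)
    self-know  : ∀ M → ⊢ ([ M ] (k CM M))
    K          : ∀ M φ ψ → ⊢ (([ M ] (φ ⇒ ψ)) ⇒ (([ M ] φ) ⇒ ([ M ] ψ)))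
    truth      : ∀ M φ → ⊢ (([ M ] φ) ⇒ (k CM M ⇒ φ))
    consistent : ∀ M φ → ⊢ (([ M ] φ) ⇒ (⟨ M ⟩ φ))
    proof      : ∀ M φ → ⊢ (φ ⇒ ([ M ] φ))
    mp         : ∀ {φ ψ} → ⊢ (φ ⇒ ψ) → ⊢ φ → ⊢ ψ
    antitone   : ∀ {M M′} → ⊢ (k CM M ⇒ k CM M′) →
                 ∀ φ → ⊢ (([ M′ ] φ) ⇒ ([ M ] φ))

{-# OPTIONS --safe #-}
module Submission where

open import Defs

-- The consistency axiom turns self-knowledge [ M ] k CM M into
-- ¬¬ (k CM M ∧ k CM M), and double negation is monotone.

-- Consistency makes any `φ` with `[ M ] φ` irrefutable jointly with `k CM M`. Choosing `k CM M`
-- itself as `φ` leaves only a duplicate conjunct to drop under `~ ~`.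

module _ (L : Language) where
  open LIiP L

  ⇒-trans : ∀ {φ ψ χ} → ⊢ φ ⇒ ψ → ⊢ ψ ⇒ χ → ⊢ φ ⇒ χ
  ⇒-trans {φ} {ψ} {χ} p q =
    mp (mp (ipc (distr φ ψ χ)) (mp (ipc (weaken (ψ ⇒ χ) φ)) q)) p

  -- Under `~ ψ`, weakening makes `φ` imply `~ ψ` as well as `ψ`, so `~-intro` refutes `φ`.
  contraposition : ∀ {φ ψ} → ⊢ φ ⇒ ψ → ⊢ ~ ψ ⇒ ~ φ
  contraposition {φ} {ψ} p =
    ⇒-trans (ipc (weaken (~ ψ) φ)) (mp (ipc (~-intro φ ψ)) p)

theorem2p11 : (L : Language) → let open LIiP L in
    (M : Msg) → ⊢ (~ (~ (k CM M)))
theorem2p11 L M =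
  mp (contraposition L (contraposition L (ipc (∧-elimˡ (k CM M) (k CM M)))))
     -- This proves `⟨ M ⟩ k CM M`, which unfolds to `~ (~ (k CM M ∧ k CM M))`.
     (mp (consistent M (k CM M)) (self-know M))
  where open LIiP L
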